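{- Let $b\ge 2$ be an integer, and let $S_n(x,y)$ be the length of the longest common substring with shifts of $x$ and $y$ in the first $n$ digits of their $b$-ary expansions. For every $0<\alpha<\infty$, the set $$S(\alpha)=\Big\{(x,y)\in(0,1]\times(0,1]:\ \lim_{n\to\infty}\frac{S_n(x,y)}{\log_b n}=\alpha\Big\}$$ is of the first category in $(0,1]\times(0,1]$. Moreover, the set $$S(0,\infty)=\Big\{(x,y)\in(0,1]\times(0,1]:\ \liminf_{n\to\infty}\frac{S_n(x,y)}{\log_b n}=0,\ \limsup_{n\to\infty}\frac{S_n(x,y)}{\log_b n}=\infty\Big\}$$ is residual in $(0,1]\times(0,1]$.
   Context: Fix an integer $b\ge2$ and let $\mathcal A=\{0,1,\dots,b-1\}$. Every $x\in(0,1]$ has a unique non-terminating $b$-ary expansion $x=\sum_{i=1}^\infty x_i b^{ -i}$ with $x_i\in\mathcal A$ (non-terminating: infinitely many $x_i$ are nonzero); $(x_1,x_2,\dots)$ is the digit sequence of $x$. Write $x_{i+1}^{i+l}=(x_{i+1},\dots,x_{i+l})$. For $(x,y)\in(0,1]^2$ and an integer $n\ge1$, $$S_n(x,y)=\max\{l\ge1:\ x_{i+1}^{i+l}=y_{j+1}^{j+l}\ \text{for some}\ 0\le i,j\le n-l\},$$ with $S_n(x,y)=0$ if no such $l$ exists. The space $(0,1]^2$ carries the usual (Euclidean subspace) topology. A set is of the first category if it is a countable union of nowhere dense sets; it is residual if its complement is of the first category. -}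

module Defs where

open import Level using (Level; 0ℓ; _⊔_) renaming (suc to lsuc)
open import Data.Nat.Base as ℕ using (ℕ; zero; suc; NonZero)
import Data.Nat.Properties as ℕ
open import Data.Integer.Base using (+_)
open import Data.Rational.Base as ℚ using (ℚ; 0ℚ; 1ℚ)
import Data.Rational.Properties as ℚ
open import Data.Fin.Base using (Fin; toℕ)
open import Data.Fin.Properties using (nonZeroIndex) renaming (_≟_ to _≟ᶠ_)
open import Data.Product.Base using (∃; ∃₂; _×_; _,_)
open import Relation.Binary.PropositionalEquality using (_≡_; _≢_)
open import Relation.Nullary using (¬_; Dec; yes; no)
open import Relation.Unary using (Pred; _∈_; _∉_; _⊆_; _≐_; ∁; U; ⋃; ⋂)

-- Dedekind cuts, read classically: a number of [-∞,∞] is the set of the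
-- rationals strictly below it, a down-closed set without greatest element.
-- The empty cut is -∞ and the full cut is ∞; every other cut is a real number.
-- Two cuts denote the same number when they have the same elements (_≃_).

record ℝ̄ : Set₁ where
  field
    below : Pred ℚ 0ℓ
    down  : ∀ {p q} → p ℚ.< q → q ∈ below → p ∈ below
    open′ : ∀ {p} → p ∈ below → ∃ λ q → p ℚ.< q × q ∈ below

open ℝ̄ public

infix 4 _≃_ _≤_ _<_

_≃_ _≤_ _<_ : ℝ̄ → ℝ̄ → Set
x ≃ y = below x ≐ below y
x ≤ y = below x ⊆ below y
x < y = ∃ λ q → q ∉ below x × q ∈ below y

-- The supremum in [-∞,∞] of a set of rationals.

supℚ : Pred ℚ 0ℓ → ℝ̄
supℚ P = record
  { below = λ q → ∃ λ r → r ∈ P × q ℚ.< r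
  ; down  = λ { p<q (r , r∈P , q<r) → r , r∈P , ℚ.<-trans p<q q<r }
  ; open′ = λ { (r , r∈P , p<r) → let m , p<m , m<r = ℚ.<-dense p<r in
                m , p<m , r , r∈P , m<r }
  }

fromℚ : ℚ → ℝ̄
fromℚ q = supℚ (_≡ q)

0# 1# ∞ : ℝ̄
0# = fromℚ 0ℚ
1# = fromℚ 1ℚ
∞  = supℚ U

sup inf : (ℕ → ℝ̄) → ℝ̄
sup s = supℚ (⋃ ℕ (λ n → below (s n)))
inf s = supℚ (⋂ ℕ (λ n → below (s n)))

infixl 6 _⊕_

_⊕_ : ℝ̄ → ℚ → ℝ̄
x ⊕ ε = supℚ (λ q → q ℚ.- ε ∈ below x)

-- |x - y| < ε, for finite x or finite y.

Near : ℚ → ℝ̄ → ℝ̄ → Set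
Near ε x y = x < y ⊕ ε × y < x ⊕ ε

-- The quotient k / y for 0 < y < ∞, as the supremum of the rationals c with
-- c r ≤ k for some positive rational r ≥ y.

infixl 7 _÷_

_÷_ : ℕ → ℝ̄ → ℝ̄
k ÷ y = supℚ λ c → ∃ λ r → 0ℚ ℚ.< r × r ∉ below y × c ℚ.* r ℚ.≤ + k ℚ./ 1

-- log_b n for b ≥ 2 and n ≥ 1, as the supremum of the rationals m / d ≥ 0
-- with b ^ (m / d) ≤ n.

log : ℕ → ℕ → ℝ̄
log b n = supℚ λ q → ∃₂ λ m d → q ≡ + m ℚ./ suc d × b ℕ.^ m ℕ.≤ n ℕ.^ suc d

-- Convergence to a finite limit.

Converges : (ℕ → ℝ̄) → ℝ̄ → Set
Converges s a =
  ∀ ε → 0ℚ ℚ.< ε → ∃ λ N → ∀ n → N ℕ.≤ n → Near ε (s n) a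

liminf limsup : (ℕ → ℝ̄) → ℝ̄
liminf s = sup λ N → inf λ n → s (N ℕ.+ n)
limsup s = inf λ N → sup λ n → s (N ℕ.+ n)

-- Indices start at 0: the digit x_i of x is the value at i - 1.

Digits : ℕ → Set
Digits b = ℕ → Fin b

partialSum : ∀ {b} → Digits b → ℕ → ℚ
partialSum     d zero    = 0ℚ
partialSum {b} d (suc n) = partialSum d n ℚ.+ (+ toℕ (d n) ℚ./ (b ℕ.^ suc n))
  where instance
    b^1+n≢0 : NonZero (b ℕ.^ suc n)
    b^1+n≢0 = ℕ.m^n≢0 b (suc n) {{nonZeroIndex (d n)}}

NonTerminating : ∀ {b} → Digits b → Set
NonTerminating d = ∀ N → ∃ λ n → N ℕ.≤ n × toℕ (d n) ≢ 0

IsDigitSequence : ∀ {b} → ℝ̄ → Digits b → Set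
IsDigitSequence x d =
  NonTerminating d × Converges (λ n → fromℚ (partialSum d n)) x

-- For l ≤ n the bound i < suc n ∸ l says i ≤ n - l.

Match : ∀ {b} → Digits b → Digits b → ℕ → ℕ → Set
Match d e n l =
  ∃ λ i → i ℕ.< suc n ℕ.∸ l ×
  ∃ λ j → j ℕ.< suc n ℕ.∸ l ×
  (∀ {k} → k ℕ.< l → d (i ℕ.+ k) ≡ e (j ℕ.+ k))

match? : ∀ {b} (d e : Digits b) n l → Dec (Match d e n l)
match? d e n l =
  ℕ.anyUpTo? (λ i →
    ℕ.anyUpTo? (λ j →
      ℕ.allUpTo? (λ k → d (i ℕ.+ k) ≟ᶠ e (j ℕ.+ k)) l)
    (suc n ℕ.∸ l))
  (suc n ℕ.∸ l)

-- The largest l with 1 ≤ l ≤ m and Match d e n l, or 0 if there is none.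

longestUpTo : ∀ {b} → Digits b → Digits b → ℕ → ℕ → ℕ
longestUpTo d e n zero    = 0
longestUpTo d e n (suc m) with match? d e n (suc m)
... | yes _ = suc m
... | no  _ = longestUpTo d e n m

longestCommon : ∀ {b} → Digits b → Digits b → ℕ → ℕ
longestCommon d e n = longestUpTo d e n n

-- The terms n = 0 and n = 1, where log_b n is not positive, carry no meaning;
-- they affect neither limits nor liminf and limsup.

ratio : ∀ {b} → Digits b → Digits b → ℕ → ℝ̄
ratio {b} d e n = longestCommon d e n ÷ log b n

record ⟨0,1] : Set₁ where
  field
    value    : ℝ̄
    positive : 0# < value
    ≤one     : value ≤ 1#

open ⟨0,1] public

Square : Set₁
Square = ⟨0,1] × ⟨0,1]

-- Open squares of half-side ε; they generate the Euclidean topology.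

Ball : Square → ℚ → Pred Square 0ℓ
Ball (x , y) ε (x′ , y′) =
  Near ε (value x) (value x′) × Near ε (value y) (value y′)

private variable
  ℓ : Level

closure : Pred Square ℓ → Pred Square (lsuc 0ℓ ⊔ ℓ)
closure A p = ∀ ε → 0ℚ ℚ.< ε → ∃ λ q → q ∈ Ball p ε × q ∈ A

interior : Pred Square ℓ → Pred Square (lsuc 0ℓ ⊔ ℓ)
interior A p = ∃ λ ε → 0ℚ ℚ.< ε × Ball p ε ⊆ A

NowhereDense : Pred Square ℓ → Set (lsuc 0ℓ ⊔ ℓ)
NowhereDense A = ∀ p → p ∉ interior (closure A)

FirstCategory : Pred Square ℓ → Set (lsuc 0ℓ ⊔ lsuc ℓ)
FirstCategory {ℓ} A =
  ∃ λ (F : ℕ → Pred Square ℓ) → (∀ n → NowhereDense (F n)) × A ≐ ⋃ ℕ F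

Residual : Pred Square ℓ → Set (lsuc 0ℓ ⊔ lsuc ℓ)
Residual A = FirstCategory (∁ A)

-- Digit sequences are unique, so it does not matter that they are quantified
-- existentially.

S : ℕ → ℝ̄ → Pred Square 0ℓ
S b α (x , y) = ∃₂ λ (d e : Digits b) →
  IsDigitSequence (value x) d × IsDigitSequence (value y) e ×
  Converges (ratio d e) α

S⟨0,∞⟩ : ℕ → Pred Square 0ℓ
S⟨0,∞⟩ b (x , y) = ∃₂ λ (d e : Digits b) →
  IsDigitSequence (value x) d × IsDigitSequence (value y) e ×
  liminf (ratio d e) ≃ 0# × limsup (ratio d e) ≃ ∞

{-# OPTIONS --safe #-}

-- Call a property of two digit sequences avoidable if every pair of prefixes
-- has an extension after which the property fails however the digits continue.
-- Every cylinder contains a ball, so the points with an avoidable property form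
-- a nowhere dense set. For each K the following two properties are avoidable:
--   t ≤ K S_{b^t} for all t ≥ K: let x continue with 0s and y with 1s, so that
--     S_n stays bounded while log_b n grows;
--   S_{b^t} ≤ K t for all t ≥ K: let both continue with 0s, so that S_n ≥ n - m
--     for prefixes of length m.
-- A point of S(α) with α > 0 has the first property for some K, and a point
-- outside S(0,∞) has one of the two for some K.

module Submission where

open import Defs
open import Level using (0ℓ; lift; lower) renaming (suc to lsuc)
open import Axiom.ExcludedMiddle using (ExcludedMiddle)
open import Data.Nat.Base as ℕ using (ℕ; zero; suc; NonZero)
import Data.Nat.Properties as ℕ
open import Data.Integer.Base as ℤ using (+_)
import Data.Integer.Properties as ℤ
open import Data.Rational.Base as ℚ using (ℚ; 0ℚ; 1ℚ)
import Data.Rational.Properties as ℚ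
import Data.Rational.Unnormalised.Base as ℚᵘ
import Data.Rational.Unnormalised.Properties as ℚᵘ
open import Algebra.Properties.Group ℚ.+-0-group using (//-rightDividesˡ; //-rightDividesʳ)
open import Data.Fin.Base using (Fin; toℕ; fromℕ<)
open import Data.Fin.Properties using (toℕ<n; toℕ-fromℕ<; toℕ-injective)
open import Data.Product.Base using (∃; ∃₂; _×_; _,_; proj₁; proj₂)
open import Data.Sum.Base using (_⊎_; inj₁; inj₂)
open import Function.Base using (_∘_; _$_; case_of_)
open import Relation.Binary.Definitions using (tri<; tri≈; tri>)
open import Relation.Binary.PropositionalEquality
open import Relation.Nullary using (¬_; Dec; yes; no; contradiction)
open import Relation.Nullary.Decidable using (map′; decidable-stable)
open import Relation.Unary using (Pred; _∈_; _∉_; _⊆_)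

-- Rationals with a natural numerator

toℚᵘ-/ : ∀ i n → ℚ.toℚᵘ (i ℚ./ suc n) ℚᵘ.≃ ℚᵘ.mkℚᵘ i n
toℚᵘ-/ i n = ℚ.toℚᵘ-fromℚᵘ (ℚᵘ.mkℚᵘ i n)

/-mono-≤ : ∀ a c m n .{{_ : NonZero m}} .{{_ : NonZero n}} →
           a ℕ.* n ℕ.≤ c ℕ.* m → + a ℚ./ m ℚ.≤ + c ℚ./ n
/-mono-≤ a c (suc m) (suc n) an≤cm = ℚ.toℚᵘ-cancel-≤ $
  ℚᵘ.≤-respˡ-≃ (ℚᵘ.≃-sym (toℚᵘ-/ (+ a) m)) $
  ℚᵘ.≤-respʳ-≃ (ℚᵘ.≃-sym (toℚᵘ-/ (+ c) n)) $
  ℚᵘ.*≤* (subst₂ ℤ._≤_ (ℤ.pos-* a (suc n)) (ℤ.pos-* c (suc m)) (ℤ.+≤+ an≤cm))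

/-cancel-≤ : ∀ a c m n .{{_ : NonZero m}} .{{_ : NonZero n}} →
             + a ℚ./ m ℚ.≤ + c ℚ./ n → a ℕ.* n ℕ.≤ c ℕ.* m
/-cancel-≤ a c (suc m) (suc n) a/m≤c/n
  with ℚᵘ.≤-respˡ-≃ (toℚᵘ-/ (+ a) m) (ℚᵘ.≤-respʳ-≃ (toℚᵘ-/ (+ c) n) (ℚ.toℚᵘ-mono-≤ a/m≤c/n))
... | ℚᵘ.*≤* an≤cm = ℤ.drop‿+≤+
  (subst₂ ℤ._≤_ (sym (ℤ.pos-* a (suc n))) (sym (ℤ.pos-* c (suc m))) an≤cm)

/-mono-< : ∀ a c m n .{{_ : NonZero m}} .{{_ : NonZero n}} →
           a ℕ.* n ℕ.< c ℕ.* m → + a ℚ./ m ℚ.< + c ℚ./ n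
/-mono-< a c m n an<cm = ℚ.≰⇒> (ℕ.<⇒≱ an<cm ∘ /-cancel-≤ c a n m)

/-cancel-< : ∀ a c m n .{{_ : NonZero m}} .{{_ : NonZero n}} →
             + a ℚ./ m ℚ.< + c ℚ./ n → a ℕ.* n ℕ.< c ℕ.* m
/-cancel-< a c m n a/m<c/n =
  ℕ.≰⇒> λ cm≤an → ℚ.<-irrefl refl (ℚ.<-≤-trans a/m<c/n (/-mono-≤ c a n m cm≤an))

/-distribʳ-+ : ∀ a c n .{{_ : NonZero n}} →
               + (a ℕ.+ c) ℚ./ n ≡ + a ℚ./ n ℚ.+ + c ℚ./ n
/-distribʳ-+ a c (suc n) = ℚ.toℚᵘ-injective $ begin
  ℚ.toℚᵘ (+ (a ℕ.+ c) ℚ./ suc n)                       ≈⟨ toℚᵘ-/ (+ (a ℕ.+ c)) n ⟩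
  ℚᵘ.mkℚᵘ (+ (a ℕ.+ c)) n                              ≈⟨ ℚᵘ.*≡* eq ⟩
  ℚᵘ.mkℚᵘ (+ a) n ℚᵘ.+ ℚᵘ.mkℚᵘ (+ c) n                 ≈⟨ ℚᵘ.+-cong (toℚᵘ-/ (+ a) n) (toℚᵘ-/ (+ c) n) ⟨
  ℚ.toℚᵘ (+ a ℚ./ suc n) ℚᵘ.+ ℚ.toℚᵘ (+ c ℚ./ suc n)   ≈⟨ ℚ.toℚᵘ-homo-+ (+ a ℚ./ suc n) (+ c ℚ./ suc n) ⟨
  ℚ.toℚᵘ (+ a ℚ./ suc n ℚ.+ + c ℚ./ suc n)             ∎
  where
  open ℚᵘ.≃-Reasoning
  eq : + (a ℕ.+ c) ℤ.* (+ suc n ℤ.* + suc n) ≡ (+ a ℤ.* + suc n ℤ.+ + c ℤ.* + suc n) ℤ.* + suc n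
  eq = trans (sym (ℤ.*-assoc (+ (a ℕ.+ c)) (+ suc n) (+ suc n)))
             (cong (ℤ._* + suc n) (trans (cong (ℤ._* + suc n) (ℤ.pos-+ a c))
                                         (ℤ.*-distribʳ-+ (+ suc n) (+ a) (+ c))))

/-homo-* : ∀ a c m n .{{_ : NonZero m}} .{{_ : NonZero n}} →
           (+ a ℚ./ m) ℚ.* (+ c ℚ./ n) ≡ (+ (a ℕ.* c) ℚ./ (m ℕ.* n)) {{ℕ.m*n≢0 m n}}
/-homo-* a c (suc m) (suc n) = ℚ.toℚᵘ-injective $ begin
  ℚ.toℚᵘ ((+ a ℚ./ suc m) ℚ.* (+ c ℚ./ suc n))         ≈⟨ ℚ.toℚᵘ-homo-* (+ a ℚ./ suc m) (+ c ℚ./ suc n) ⟩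
  ℚ.toℚᵘ (+ a ℚ./ suc m) ℚᵘ.* ℚ.toℚᵘ (+ c ℚ./ suc n)   ≈⟨ ℚᵘ.*-cong (toℚᵘ-/ (+ a) m) (toℚᵘ-/ (+ c) n) ⟩
  ℚᵘ.mkℚᵘ (+ a) m ℚᵘ.* ℚᵘ.mkℚᵘ (+ c) n                 ≈⟨ ℚᵘ.*≡* (cong (ℤ._* + (suc m ℕ.* suc n)) (sym (ℤ.pos-* a c))) ⟩
  ℚᵘ.mkℚᵘ (+ (a ℕ.* c)) (ℕ.pred (suc m ℕ.* suc n))     ≈⟨ toℚᵘ-/ (+ (a ℕ.* c)) (ℕ.pred (suc m ℕ.* suc n)) ⟨
  ℚ.toℚᵘ (+ (a ℕ.* c) ℚ./ (suc m ℕ.* suc n))           ∎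
  where open ℚᵘ.≃-Reasoning

-- A positive numerator is at least 1. This is how a denominator serves later as an explicit
-- Archimedean bound.
1/↧≤ : ∀ {q} → 0ℚ ℚ.< q → + 1 ℚ./ ℚ.↧ₙ q ℚ.≤ q
1/↧≤ {q@(ℚ.mkℚ (+ suc a) d-1 _)} _ = subst (+ 1 ℚ./ ℚ.↧ₙ q ℚ.≤_) (ℚ.↥p/↧p≡p q)
  (/-mono-≤ 1 (suc a) (suc d-1) (suc d-1) (ℕ.*-monoˡ-≤ (suc d-1) (ℕ.s≤s {n = a} ℕ.z≤n)))
1/↧≤ {ℚ.mkℚ (+ zero) _ _}    (ℚ.*<* (ℤ.+<+ ()))
1/↧≤ {ℚ.mkℚ ℤ.-[1+ _ ] _ _} (ℚ.*<* ())

≤∣↥∣ : ∀ q → q ℚ.≤ + ℤ.∣ ℚ.↥ q ∣ ℚ./ 1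
≤∣↥∣ q@(ℚ.mkℚ (+ a) d-1 _) = subst (ℚ._≤ + a ℚ./ 1) (ℚ.↥p/↧p≡p q)
  (/-mono-≤ a a (suc d-1) 1 (ℕ.*-monoʳ-≤ a (ℕ.s≤s {n = d-1} ℕ.z≤n)))
≤∣↥∣ q@(ℚ.mkℚ ℤ.-[1+ a ] d-1 _) = ℚ.≤-trans
  (ℚ.<⇒≤ (ℚ.*<* {q = 0ℚ} ℤ.-<+))
  (/-mono-≤ 0 (suc a) 1 1 ℕ.z≤n)

x-y<z⇒x<z+y : ∀ {x y z} → x ℚ.- y ℚ.< z → x ℚ.< z ℚ.+ y
x-y<z⇒x<z+y {x} {y} {z} h = subst (ℚ._< z ℚ.+ y) (//-rightDividesˡ y x) (ℚ.+-monoˡ-< y h)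

x+[y-x]≡y : ∀ x y → x ℚ.+ (y ℚ.- x) ≡ y
x+[y-x]≡y x y = trans (ℚ.+-comm x _) (//-rightDividesˡ x y)

x<y⇒0<y-x : ∀ {x y} → x ℚ.< y → 0ℚ ℚ.< y ℚ.- x
x<y⇒0<y-x {x} {y} x<y = subst (ℚ._< y ℚ.- x) (ℚ.+-inverseʳ x) (ℚ.+-monoˡ-< (ℚ.- x) x<y)

x<y+z⇒x-z<y : ∀ {x y z} → x ℚ.< y ℚ.+ z → x ℚ.- z ℚ.< y
x<y+z⇒x-z<y {x} {y} {z} h = subst (x ℚ.- z ℚ.<_) (//-rightDividesʳ z y) (ℚ.+-monoˡ-< (ℚ.- z) h)

+-cancelʳ-< : ∀ {x y} z → x ℚ.+ z ℚ.< y ℚ.+ z → x ℚ.< y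
+-cancelʳ-< z x+z<y+z = ℚ.≰⇒> λ y≤x → ℚ.<-irrefl refl (ℚ.<-≤-trans x+z<y+z (ℚ.+-monoˡ-≤ z y≤x))

-- Cuts

below-≤ : ∀ x {p q} → p ℚ.≤ q → q ∈ below x → p ∈ below x
below-≤ x {p} {q} p≤q q∈x with ℚ.<-cmp p q
... | tri< p<q _ _  = down x p<q q∈x
... | tri≈ _ refl _ = q∈x
... | tri> _ _ p>q  = contradiction (ℚ.≤-<-trans p≤q p>q) (ℚ.<-irrefl refl)

∈∉⇒< : ∀ x {p q} → p ∈ below x → q ∉ below x → p ℚ.< q
∈∉⇒< x p∈x q∉x = ℚ.≰⇒> λ q≤p → q∉x (below-≤ x q≤p p∈x)

∉fromℚ : ∀ {p q} → p ℚ.≤ q → q ∉ below (fromℚ p)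
∉fromℚ p≤q (_ , refl , q<p) = ℚ.<-irrefl refl (ℚ.≤-<-trans p≤q q<p)

∉fromℚ⇒≤ : ∀ {p q} → q ∉ below (fromℚ p) → p ℚ.≤ q
∉fromℚ⇒≤ q∉p = ℚ.≮⇒≥ λ q<p → q∉p (_ , refl , q<p)

<⊕-intro : ∀ x y {ε q r} → q ∉ below x → r ∈ below y → q ℚ.< r ℚ.+ ε → x < y ⊕ ε
<⊕-intro x y {ε} {q} {r} q∉x r∈y q<r+ε =
  q , q∉x , r ℚ.+ ε , subst (_∈ below y) (sym (//-rightDividesʳ ε r)) r∈y , q<r+ε

<⊕-elim : ∀ x y {ε} → x < y ⊕ ε → ∃₂ λ q r → q ∉ below x × r ∈ below y × q ℚ.< r ℚ.+ ε
<⊕-elim x y {ε} (q , q∉x , s , s-ε∈y , q<s) =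
  q , s ℚ.- ε , q∉x , s-ε∈y , ℚ.<-≤-trans q<s (ℚ.≤-reflexive (sym (//-rightDividesˡ ε s)))

-- Digit sequences

-- Discrete intermediate value principle; `subcell` finds the next digit with it.
bracket : ∀ {ℓ} {P : Pred ℕ ℓ} → (∀ i → Dec (P i)) → ∀ m → P 0 → ¬ P m →
          ∃ λ i → i ℕ.< m × P i × ¬ P (suc i)
bracket P? zero    p₀ ¬pₘ = contradiction p₀ ¬pₘ
bracket P? (suc m) p₀ ¬pₘ with P? m
... | yes pₘ = m , ℕ.≤-refl , pₘ , ¬pₘ
... | no ¬pₘ′ with bracket P? m p₀ ¬pₘ′
...   | i , i<m , rest = i , ℕ.m<n⇒m<1+n i<m , rest

Agree : ∀ {b} → ℕ → Digits b → Digits b → Set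
Agree m d e = ∀ {k} → k ℕ.< m → d k ≡ e k

-- `S b α` and `S⟨0,∞⟩ b` have this form, with a condition on the ratios as `P`.
Realised : ∀ {b} → (Digits b → Digits b → Set) → Pred Square 0ℓ
Realised P (x , y) = ∃₂ λ d e →
  IsDigitSequence (value x) d × IsDigitSequence (value y) e × P d e

-- Horner's scheme: the n-th partial sum is this integer over `b ^ n`.
numerator : ∀ {b} → Digits b → ℕ → ℕ
numerator     d zero    = 0
numerator {b} d (suc n) = b ℕ.* numerator d n ℕ.+ toℕ (d n)

numerator-cong : ∀ {b} {d e : Digits b} n → Agree n d e → numerator d n ≡ numerator e n
numerator-cong     zero    _   = refl
numerator-cong {b} (suc n) d≡e = cong₂ (λ c i → b ℕ.* c ℕ.+ toℕ i)
  (numerator-cong n (d≡e ∘ ℕ.m<n⇒m<1+n)) (d≡e ℕ.≤-refl)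

-- A digit is less than `b`, so it cannot make up for a smaller leading part.
*+-< : ∀ {b c c′} (i : Fin b) j → c ℕ.< c′ → b ℕ.* c ℕ.+ toℕ i ℕ.< b ℕ.* c′ ℕ.+ j
*+-< {b} {c} {c′} i j c<c′ = begin-strict
  b ℕ.* c ℕ.+ toℕ i  <⟨ ℕ.+-monoʳ-< (b ℕ.* c) (toℕ<n i) ⟩
  b ℕ.* c ℕ.+ b      ≡⟨ ℕ.+-comm (b ℕ.* c) b ⟩
  b ℕ.+ b ℕ.* c      ≡⟨ ℕ.*-suc b c ⟨
  b ℕ.* suc c        ≤⟨ ℕ.*-monoʳ-≤ b c<c′ ⟩
  b ℕ.* c′           ≤⟨ ℕ.m≤m+n _ j ⟩
  b ℕ.* c′ ℕ.+ j     ∎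
  where open ℕ.≤-Reasoning

-- By `*+-<` the last digits cannot cancel a difference between the shorter numerators, so those
-- coincide, and then so do the last digits.
numerator-injective : ∀ {b} {d e : Digits b} n → numerator d n ≡ numerator e n → Agree n d e
numerator-injective {b} {d} {e} (suc n) eq {k} k<1+n
  with ℕ.<-cmp (numerator d n) (numerator e n)
... | tri< d<e _ _ = contradiction eq (ℕ.<⇒≢ (*+-< (d n) (toℕ (e n)) d<e))
... | tri> _ _ e<d = contradiction (sym eq) (ℕ.<⇒≢ (*+-< (e n) (toℕ (d n)) e<d))
... | tri≈ _ eq′ _ with ℕ.m≤n⇒m<n∨m≡n (ℕ.≤-pred k<1+n)
...   | inj₁ k<n  = numerator-injective n eq′ k<n
...   | inj₂ refl = toℕ-injective (ℕ.+-cancelˡ-≡ (b ℕ.* numerator e n) _ _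
          (subst (λ c → b ℕ.* c ℕ.+ toℕ (d n) ≡ _) eq′ eq))

-- Avoidable properties

AvoidingExtension : ∀ {b} → (Digits b → Digits b → Set) → Digits b → Digits b → ℕ → Set
AvoidingExtension P d e m = ∃₂ λ d′ e′ → ∃ λ n → m ℕ.≤ n × Agree m d d′ × Agree m e e′ ×
  (∀ {d″ e″} → Agree n d′ d″ → Agree n e′ e″ → ¬ P d″ e″)

Avoidable : ∀ {b} → (Digits b → Digits b → Set) → Set
Avoidable P = ∀ d e m → AvoidingExtension P d e m

-- Extend against `P` first, then extend the result against `Q`: the failure of `P` survives every
-- further continuation.
avoidable-⊎ : ∀ {b} {P Q : Digits b → Digits b → Set} → Avoidable P → Avoidable Q →
              Avoidable (λ d e → P d e ⊎ Q d e)
avoidable-⊎ {b} avoidP avoidQ d e m with avoidP d e m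
... | d₁ , e₁ , n₁ , m≤n₁ , d≡d₁ , e≡e₁ , ¬P with avoidQ d₁ e₁ n₁
... | d₂ , e₂ , n₂ , n₁≤n₂ , d₁≡d₂ , e₁≡e₂ , ¬Q =
  d₂ , e₂ , n₂ , ℕ.≤-trans m≤n₁ n₁≤n₂ , extend d≡d₁ d₁≡d₂ m≤n₁ , extend e≡e₁ e₁≡e₂ m≤n₁ ,
  λ { d₂≡d e₂≡e (inj₁ p) → ¬P (extend d₁≡d₂ d₂≡d n₁≤n₂) (extend e₁≡e₂ e₂≡e n₁≤n₂) p
    ; d₂≡d e₂≡e (inj₂ q) → ¬Q d₂≡d e₂≡e q }
  where
  extend : ∀ {k l} {f g h : Digits b} → Agree k f g → Agree l g h → k ℕ.≤ l → Agree k f h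
  extend f≡g g≡h k≤l i<k = trans (f≡g i<k) (g≡h (ℕ.<-≤-trans i<k k≤l))

-- Common substrings of sequences with constant tails

splice : ∀ {b} → ℕ → Digits b → Fin b → Digits b
splice m d i k with k ℕ.<? m
... | yes _ = d k
... | no  _ = i

agree-splice : ∀ {b} m (d : Digits b) i → Agree m d (splice m d i)
agree-splice m d i {k} k<m with k ℕ.<? m
... | yes _   = refl
... | no  k≮m = contradiction k<m k≮m

splice-tail : ∀ {b} {m} (d : Digits b) i {k} → m ℕ.≤ k → splice m d i k ≡ i
splice-tail {m = m} d i {k} m≤k with k ℕ.<? m
... | yes k<m = contradiction m≤k (ℕ.<⇒≱ k<m)
... | no  _   = refl

m<n∸o⇒m+o<n : ∀ {m n} o → m ℕ.< n ℕ.∸ o → m ℕ.+ o ℕ.< n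
m<n∸o⇒m+o<n {m} {n} o m<n∸o = ℕ.≰⇒> λ n≤m+o →
  ℕ.<⇒≱ m<n∸o (ℕ.m≤n+o⇒m∸n≤o n o (ℕ.≤-trans n≤m+o (ℕ.≤-reflexive (ℕ.+-comm m o))))

module _ {b : ℕ} {d e : Digits b} {n : ℕ} where

  longestUpTo-≥ : ∀ m {l} → l ℕ.≤ m → Match d e n l → l ℕ.≤ longestUpTo d e n m
  longestUpTo-≥ zero    ℕ.z≤n _     = ℕ.z≤n
  longestUpTo-≥ (suc m) l≤1+m match with match? d e n (suc m)
  ... | yes _ = l≤1+m
  ... | no ¬match with ℕ.m≤n⇒m<n∨m≡n l≤1+m
  ...   | inj₁ l<1+m = longestUpTo-≥ m (ℕ.≤-pred l<1+m) match
  ...   | inj₂ refl  = contradiction match ¬match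

  longestUpTo-≤ : ∀ {B} m → (∀ {l} → Match d e n l → l ℕ.≤ B) → longestUpTo d e n m ℕ.≤ B
  longestUpTo-≤ zero    bound = ℕ.z≤n
  longestUpTo-≤ (suc m) bound with match? d e n (suc m)
  ... | yes match = bound match
  ... | no  _     = longestUpTo-≤ m bound

  -- A match of length above `m`, read at offset `m`, compares a digit of one tail with a digit of
  -- the other, that is `i` with `j`.
  disagreeing-tails : ∀ {i j m n′} {d′ e′ : Digits b} → i ≢ j → n ℕ.≤ n′ →
    Agree n′ (splice m d′ i) d → Agree n′ (splice m e′ j) e → longestCommon d e n ℕ.≤ m
  disagreeing-tails {i} {j} {m} {n′} {d′} {e′} i≢j n≤n′ d≡ e≡ = longestUpTo-≤ n bound
    where
    bound : ∀ {l} → Match d e n l → l ℕ.≤ m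
    bound {l} (p , p< , q , q< , match) = ℕ.≮⇒≥ λ m<l → i≢j (begin
      i                               ≡⟨ splice-tail d′ i (ℕ.m≤n+m m p) ⟨
      splice m d′ i (p ℕ.+ m)         ≡⟨ d≡ (inside p p< m<l) ⟩
      d (p ℕ.+ m)                     ≡⟨ match m<l ⟩
      e (q ℕ.+ m)                     ≡⟨ e≡ (inside q q< m<l) ⟨
      splice m e′ j (q ℕ.+ m)         ≡⟨ splice-tail e′ j (ℕ.m≤n+m m q) ⟩
      j                               ∎)
      where
      open ≡-Reasoning
      inside : ∀ p → p ℕ.< suc n ℕ.∸ l → m ℕ.< l → p ℕ.+ m ℕ.< n′
      inside p p< m<l = ℕ.<-≤-trans (ℕ.+-monoʳ-< p m<l)
        (ℕ.≤-trans (ℕ.≤-pred (m<n∸o⇒m+o<n l p<)) n≤n′)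

  -- The two constant tails, both starting at `m`, match up to position `n`.
  agreeing-tails : ∀ {i m n′} {d′ e′ : Digits b} → m ℕ.≤ n → n ℕ.≤ n′ →
    Agree n′ (splice m d′ i) d → Agree n′ (splice m e′ i) e → n ℕ.∸ m ℕ.≤ longestCommon d e n
  agreeing-tails {i} {m} {n′} {d′} {e′} m≤n n≤n′ d≡ e≡ =
    longestUpTo-≥ n (ℕ.m∸n≤m n m) (m , m< , m , m< , λ {k} k< → begin
      d (m ℕ.+ k)                 ≡⟨ d≡ (inside k<) ⟨
      splice m d′ i (m ℕ.+ k)     ≡⟨ splice-tail d′ i (ℕ.m≤m+n m k) ⟩
      i                           ≡⟨ splice-tail e′ i (ℕ.m≤m+n m k) ⟨
      splice m e′ i (m ℕ.+ k)     ≡⟨ e≡ (inside k<) ⟩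
      e (m ℕ.+ k)                 ∎)
    where
    open ≡-Reasoning
    -- The right side equals `suc m`, so `m` is the last admissible starting position.
    m< : m ℕ.< suc n ℕ.∸ (n ℕ.∸ m)
    m< = ℕ.≤-reflexive (sym (trans (ℕ.+-∸-assoc 1 (ℕ.m∸n≤m n m)) (cong suc (ℕ.m∸[m∸n]≡n m≤n))))
    inside : ∀ {k} → k ℕ.< n ℕ.∸ m → m ℕ.+ k ℕ.< n′
    inside {k} k< = ℕ.<-≤-trans (subst (ℕ._< n) (ℕ.+-comm k m) (m<n∸o⇒m+o<n m k<)) n≤n′

-- Sampling at `b ^ t` replaces the logarithm by `t`. A single `K` is both factor and threshold, so
-- the family is countable.
LongAtPowers ShortAtPowers : ∀ {b} → ℕ → Digits b → Digits b → Set
LongAtPowers  {b} K d e = ∀ t → K ℕ.≤ t → t ℕ.≤ K ℕ.* longestCommon d e (b ℕ.^ t)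
ShortAtPowers {b} K d e = ∀ t → K ℕ.≤ t → longestCommon d e (b ℕ.^ t) ℕ.≤ K ℕ.* t

-- Cells of the b-adic grid

module _ {b : ℕ} (2≤b : 2 ℕ.≤ b) where

  private instance
    b≢0 : NonZero b
    b≢0 = ℕ.>-nonZero (ℕ.≤-trans (ℕ.n≤1+n 1) 2≤b)

  n<b^n : ∀ n → n ℕ.< b ℕ.^ n
  n<b^n zero    = ℕ.s≤s ℕ.z≤n
  n<b^n (suc n) = begin-strict
    suc n               <⟨ ℕ.s≤s (n<b^n n) ⟩
    1 ℕ.+ b ℕ.^ n       ≤⟨ ℕ.+-monoˡ-≤ _ (ℕ.m^n>0 b n) ⟩
    b ℕ.^ n ℕ.+ b ℕ.^ n ≡⟨ cong (b ℕ.^ n ℕ.+_) (ℕ.+-identityʳ _) ⟨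
    2 ℕ.* b ℕ.^ n       ≤⟨ ℕ.*-monoˡ-≤ (b ℕ.^ n) 2≤b ⟩
    b ℕ.* b ℕ.^ n       ∎
    where open ℕ.≤-Reasoning

  -- Opaque, since unifying two quotients unfolds their normalisation.
  abstract
    mesh : ℕ → ℕ → ℚ
    mesh c n = ℚ._/_ (+ c) (b ℕ.^ n) {{ℕ.m^n≢0 b n}}

    mesh≡/ : ∀ c n → mesh c n ≡ ℚ._/_ (+ c) (b ℕ.^ n) {{ℕ.m^n≢0 b n}}
    mesh≡/ c n = refl

  module _ (n : ℕ) where
    private instance
      b^n≢0 : NonZero (b ℕ.^ n)
      b^n≢0 = ℕ.m^n≢0 b n

    abstract
      mesh-mono-≤ : ∀ {c c′} → c ℕ.≤ c′ → mesh c n ℚ.≤ mesh c′ n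
      mesh-mono-≤ {c} {c′} c≤c′ =
        /-mono-≤ c c′ (b ℕ.^ n) (b ℕ.^ n) (ℕ.*-monoˡ-≤ (b ℕ.^ n) c≤c′)

      mesh-mono-< : ∀ {c c′} → c ℕ.< c′ → mesh c n ℚ.< mesh c′ n
      mesh-mono-< {c} {c′} c<c′ =
        /-mono-< c c′ (b ℕ.^ n) (b ℕ.^ n) (ℕ.*-monoˡ-< (b ℕ.^ n) c<c′)

      mesh-cancel-< : ∀ c c′ → mesh c n ℚ.< mesh c′ n → c ℕ.< c′
      mesh-cancel-< c c′ h = ℕ.*-cancelʳ-< (b ℕ.^ n) c c′ (/-cancel-< c c′ (b ℕ.^ n) (b ℕ.^ n) h)

      mesh-+ : ∀ c c′ → mesh (c ℕ.+ c′) n ≡ mesh c n ℚ.+ mesh c′ n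
      mesh-+ c c′ = /-distribʳ-+ c c′ (b ℕ.^ n)

      mesh-0 : mesh 0 n ≡ 0ℚ
      mesh-0 = ℚ.0/n≡0 (b ℕ.^ n)

      mesh-refine : ∀ c → mesh c n ≡ mesh (b ℕ.* c) (suc n)
      mesh-refine c = ℚ.≤-antisym
        (/-mono-≤ c (b ℕ.* c) (b ℕ.^ n) (b ℕ.^ suc n) {{b^n≢0}} {{ℕ.m^n≢0 b (suc n)}}
          (ℕ.≤-reflexive eq))
        (/-mono-≤ (b ℕ.* c) c (b ℕ.^ suc n) (b ℕ.^ n) {{ℕ.m^n≢0 b (suc n)}}
          (ℕ.≤-reflexive (sym eq)))
        where
        eq : c ℕ.* (b ℕ.* b ℕ.^ n) ≡ b ℕ.* c ℕ.* b ℕ.^ n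
        eq = trans (sym (ℕ.*-assoc c b _)) (cong (ℕ._* b ℕ.^ n) (ℕ.*-comm c b))

      -- Since `b ^ n` exceeds `n`, the denominator of `ε` is already a sufficient depth.
      mesh-small : ∀ {ε} → ℚ.↧ₙ ε ℕ.≤ n → 0ℚ ℚ.< ε → mesh 1 n ℚ.< ε
      mesh-small {ε} N≤n 0<ε = ℚ.<-≤-trans
        (/-mono-< 1 1 (b ℕ.^ n) (ℚ.↧ₙ ε) (ℕ.*-monoʳ-< 1 (ℕ.≤-<-trans N≤n (n<b^n n))))
        (1/↧≤ 0<ε)

  -- c / b^n < x ≤ (c + 1) / b^n: non-terminating expansions go with left-open cells.
  InCell : ℝ̄ → ℕ → ℕ → Set
  InCell x n c = mesh c n ∈ below x × mesh (suc c) n ∉ below x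

  inCell-unique : ∀ x n {c c′} → InCell x n c → InCell x n c′ → c ≡ c′
  inCell-unique x n {c} {c′} (c∈x , 1+c∉x) (c′∈x , 1+c′∉x) = ℕ.≤-antisym
    (ℕ.≤-pred (mesh-cancel-< n c (suc c′) (∈∉⇒< x c∈x 1+c′∉x)))
    (ℕ.≤-pred (mesh-cancel-< n c′ (suc c) (∈∉⇒< x c′∈x 1+c∉x)))

  module _ (d : Digits b) where

    lower-end upper-end : ℕ → ℚ
    lower-end n = mesh (numerator d n) n
    upper-end n = mesh (suc (numerator d n)) n

    partialSum≡lower-end : ∀ n → partialSum d n ≡ lower-end n
    partialSum≡lower-end zero    = sym (mesh-0 0)
    partialSum≡lower-end (suc n) =
      trans (cong₂ ℚ._+_ (trans (partialSum≡lower-end n) (mesh-refine n _))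
                         (sym (mesh≡/ (toℕ (d n)) (suc n))))
            (sym (mesh-+ (suc n) (b ℕ.* numerator d n) (toℕ (d n))))

    lower-end-mono : ∀ {m n} → m ℕ.≤′ n → lower-end m ℚ.≤ lower-end n
    lower-end-mono         ℕ.≤′-refl           = ℚ.≤-refl
    lower-end-mono {m} {n} (ℕ.≤′-step {k} m≤k) = ℚ.≤-trans (lower-end-mono m≤k)
      (ℚ.≤-trans (ℚ.≤-reflexive (mesh-refine k (numerator d k)))
                 (mesh-mono-≤ (suc k) (ℕ.m≤m+n _ (toℕ (d k)))))

    upper-end-anti : ∀ {m n} → m ℕ.≤′ n → upper-end n ℚ.≤ upper-end m
    upper-end-anti         ℕ.≤′-refl           = ℚ.≤-refl
    upper-end-anti {m} {n} (ℕ.≤′-step {k} m≤k) = ℚ.≤-trans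
      (ℚ.≤-trans (mesh-mono-≤ (suc k)
                   (ℕ.≤-trans (*+-< (d k) 0 (ℕ.n<1+n (numerator d k))) (ℕ.≤-reflexive (ℕ.+-identityʳ _))))
                 (ℚ.≤-reflexive (sym (mesh-refine k (suc (numerator d k))))))
      (upper-end-anti m≤k)

    upper-end≡ : ∀ n → upper-end n ≡ lower-end n ℚ.+ mesh 1 n
    upper-end≡ n = trans (cong (λ c → mesh c n) (sym (ℕ.+-comm (numerator d n) 1)))
                         (mesh-+ n (numerator d n) 1)

    lower-end-< : ∀ n → toℕ (d n) ≢ 0 → lower-end n ℚ.< lower-end (suc n)
    lower-end-< n dₙ≢0 = ℚ.≤-<-trans (ℚ.≤-reflexive (mesh-refine n (numerator d n)))
      (mesh-mono-< (suc n) (ℕ.m<m+n _ (ℕ.n≢0⇒n>0 dₙ≢0)))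

    -- A nonzero digit after position `n` lifts the later partial sums strictly above the lower end,
    -- which gives the strict inequality on the left. No partial sum exceeds the upper end, so
    -- neither does the limit.
    digits⇒cells : ∀ x → IsDigitSequence x d → ∀ n → InCell x n (numerator d n)
    digits⇒cells x (nt , conv) n = lower∈ , upper∉
      where
      lower∈ : lower-end n ∈ below x
      lower∈ with nt n
      ... | k , n≤k , dₖ≢0
        with conv (lower-end (suc k) ℚ.- lower-end n)
                  (x<y⇒0<y-x (ℚ.≤-<-trans (lower-end-mono (ℕ.≤⇒≤′ n≤k)) (lower-end-< k dₖ≢0)))
      ... | N , near
        -- The index lies beyond both the threshold `N` and the nonzero digit at `k`.
        with <⊕-elim (fromℚ (partialSum d (N ℕ.+ suc k))) x (proj₁ (near (N ℕ.+ suc k) (ℕ.m≤m+n N (suc k))))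
      ... | q , r , q∉ , r∈x , q<r+ε =
        down x (+-cancelʳ-< (lower-end (suc k) ℚ.- lower-end n) (ℚ.≤-<-trans end≤q q<r+ε)) r∈x
        where
        end≤q : lower-end n ℚ.+ (lower-end (suc k) ℚ.- lower-end n) ℚ.≤ q
        end≤q = ℚ.≤-trans (ℚ.≤-reflexive (x+[y-x]≡y (lower-end n) (lower-end (suc k))))
          (ℚ.≤-trans (lower-end-mono (ℕ.≤⇒≤′ (ℕ.m≤n+m (suc k) N)))
          (ℚ.≤-trans (ℚ.≤-reflexive (sym (partialSum≡lower-end (N ℕ.+ suc k)))) (∉fromℚ⇒≤ q∉)))

      upper∉ : upper-end n ∉ below x
      upper∉ u∈x with open′ x u∈x
      -- If the upper end were below `r` and `r` below `x`, partial sums this close to `x` would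
      -- have to pass the upper end.
      ... | r , u<r , r∈x with conv (r ℚ.- upper-end n) (x<y⇒0<y-x u<r)
      ... | N , near
        with <⊕-elim x (fromℚ (partialSum d (N ℕ.+ n))) (proj₂ (near (N ℕ.+ n) (ℕ.m≤m+n N n)))
      ... | q , s , q∉x , (_ , refl , s<P) , q<s+ε = q∉x (down x q<r r∈x)
        where
        s<u : s ℚ.< upper-end n
        s<u = ℚ.<-≤-trans s<P (ℚ.≤-trans (ℚ.≤-reflexive (partialSum≡lower-end (N ℕ.+ n)))
          (ℚ.≤-trans (mesh-mono-≤ (N ℕ.+ n) (ℕ.n≤1+n _)) (upper-end-anti (ℕ.≤⇒≤′ (ℕ.m≤n+m n N)))))
        q<r : q ℚ.< r
        q<r = ℚ.<-trans q<s+ε (ℚ.<-≤-trans (ℚ.+-monoˡ-< (r ℚ.- upper-end n) s<u)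
                                           (ℚ.≤-reflexive (x+[y-x]≡y (upper-end n) r)))

    -- The partial sum is the lower end of a cell around `x` whose length is below `ε`.
    cells⇒converges : ∀ x → (∀ n → InCell x n (numerator d n)) →
                      Converges (λ n → fromℚ (partialSum d n)) x
    cells⇒converges x cells ε 0<ε = ℚ.↧ₙ ε , λ n N≤n →
      let
        P = partialSum d n
        P≡lower = partialSum≡lower-end n
        lower∈x , upper∉x = cells n
        lower<upper = mesh-mono-< n (ℕ.n<1+n (numerator d n))
        upper<lower+ε = ℚ.≤-<-trans (ℚ.≤-reflexive (upper-end≡ n))
                                    (ℚ.+-monoʳ-< (lower-end n) (mesh-small n N≤n 0<ε))
        -- The cut of the partial sum contains only rationals strictly below it, hence the
        -- intermediate `r`.
        r , upper-ε<r , r<lower = ℚ.<-dense (x<y+z⇒x-z<y upper<lower+ε)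
      in <⊕-intro (fromℚ P) x (∉fromℚ (ℚ.≤-reflexive P≡lower)) lower∈x
           (ℚ.<-trans lower<upper upper<lower+ε)
       , <⊕-intro x (fromℚ P) upper∉x (P , refl , ℚ.<-≤-trans r<lower (ℚ.≤-reflexive (sym P≡lower)))
           (x-y<z⇒x<z+y upper-ε<r)

  -- Existence of digit sequences

  module _ (em : ExcludedMiddle 0ℓ) where

    -- If all digits from `N` on were 0, the lower ends would stay constant while the cells shrink.
    -- The upper ends would then drop below a rational `r` that is itself below `x`.
    cells⇒nonTerminating : ∀ x (d : Digits b) → (∀ n → InCell x n (numerator d n)) → NonTerminating d
    cells⇒nonTerminating x d cells N with em {∃ λ n → N ℕ.≤ n × toℕ (d n) ≢ 0}
    ... | yes nonzero = nonzero
    ... | no  allzero with open′ x (proj₁ (cells N))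
    ... | r , lower<r , r∈x = contradiction (down x upper<r r∈x) (proj₂ (cells (M ℕ.+ N)))
      where
      M = ℚ.↧ₙ (r ℚ.- lower-end d N)
      lower-end-const : ∀ {n} → N ℕ.≤′ n → lower-end d n ≡ lower-end d N
      lower-end-const ℕ.≤′-refl = refl
      lower-end-const (ℕ.≤′-step {k} N≤k) = trans
        (cong (λ c → mesh c (suc k)) (trans (cong (b ℕ.* numerator d k ℕ.+_) zero-digit) (ℕ.+-identityʳ _)))
        (trans (sym (mesh-refine k (numerator d k))) (lower-end-const N≤k))
        where
        zero-digit : toℕ (d k) ≡ 0
        zero-digit = decidable-stable (toℕ (d k) ℕ.≟ 0) λ dₖ≢0 → allzero (k , ℕ.≤′⇒≤ N≤k , dₖ≢0)
      upper<r : upper-end d (M ℕ.+ N) ℚ.< r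
      upper<r = ℚ.≤-<-trans
        (ℚ.≤-reflexive (trans (upper-end≡ d (M ℕ.+ N))
          (cong (ℚ._+ mesh 1 (M ℕ.+ N)) (lower-end-const (ℕ.≤⇒≤′ (ℕ.m≤n+m N M))))))
        (ℚ.<-≤-trans (ℚ.+-monoʳ-< (lower-end d N)
                       (mesh-small (M ℕ.+ N) (ℕ.m≤m+n M N) (x<y⇒0<y-x lower<r)))
                     (ℚ.≤-reflexive (x+[y-x]≡y (lower-end d N) r)))

    -- Among the division points of the cell, the one for 0 is below `x` and the one for `b` is not;
    -- the digit is where this changes.
    subcell : ∀ x n {c} → InCell x n c → ∃ λ (i : Fin b) → InCell x (suc n) (b ℕ.* c ℕ.+ toℕ i)
    subcell x n {c} (c∈x , 1+c∉x)
      with bracket {P = λ i → mesh (b ℕ.* c ℕ.+ i) (suc n) ∈ below x} (λ _ → em) b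
             (subst (_∈ below x) first c∈x) (1+c∉x ∘ subst (_∈ below x) last)
      where
      first : mesh c n ≡ mesh (b ℕ.* c ℕ.+ 0) (suc n)
      first = trans (mesh-refine n c) (cong (λ i → mesh i (suc n)) (sym (ℕ.+-identityʳ _)))
      last : mesh (b ℕ.* c ℕ.+ b) (suc n) ≡ mesh (suc c) n
      last = trans (cong (λ i → mesh i (suc n)) (trans (ℕ.+-comm _ b) (sym (ℕ.*-suc b c))))
                   (sym (mesh-refine n (suc c)))
    ... | i , i<b , i∈x , 1+i∉x = fromℕ< i<b ,
      subst (λ j → InCell x (suc n) (b ℕ.* c ℕ.+ j)) (sym (toℕ-fromℕ< i<b))
        (i∈x , 1+i∉x ∘ subst (λ j → mesh j (suc n) ∈ below x) (sym (ℕ.+-suc _ i)))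

    module _ (x : ⟨0,1]) where

      private
        x∈cell₀ : InCell (value x) 0 0
        x∈cell₀ with positive x
        ... | q , q∉0 , q∈x =
          subst (_∈ below (value x)) (sym (mesh-0 0)) (below-≤ (value x) (∉fromℚ⇒≤ q∉0) q∈x) ,
          ∉fromℚ (ℚ.≤-reflexive (sym (mesh≡/ 1 0))) ∘ ≤one x

        cell : ∀ n → ∃ λ c → InCell (value x) n c
        cell zero    = 0 , x∈cell₀
        cell (suc n) = _ , proj₂ (subcell (value x) n (proj₂ (cell n)))

        digit : Digits b
        digit n = proj₁ (subcell (value x) n (proj₂ (cell n)))

        numerator≡ : ∀ n → numerator digit n ≡ proj₁ (cell n)
        numerator≡ zero    = refl
        numerator≡ (suc n) = cong (λ c → b ℕ.* c ℕ.+ toℕ (digit n)) (numerator≡ n)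

        cells : ∀ n → InCell (value x) n (numerator digit n)
        cells n = subst (InCell (value x) n) (sym (numerator≡ n)) (proj₂ (cell n))

      -- Membership in the unit cell is the condition 0 < x ≤ 1; from there `subcell` is iterated.
      digits-exist : ∃ λ d → IsDigitSequence (value x) d
      digits-exist = digit , cells⇒nonTerminating (value x) digit cells , cells⇒converges digit (value x) cells

  -- Balls inside cylinders

  module _ (d : Digits b) (n : ℕ) where

    private
      c = numerator d n

    -- At distance at least 1 / b^(n+1) from both ends of its cell, because b ≥ 2.
    interior-point : ℚ
    interior-point = mesh (1 ℕ.+ b ℕ.* c) (suc n)

    lower-end<interior-point : lower-end d n ℚ.< interior-point
    lower-end<interior-point = ℚ.≤-<-trans (ℚ.≤-reflexive (mesh-refine n c))
                                           (mesh-mono-< (suc n) (ℕ.n<1+n _))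

    interior-point+mesh≤upper-end : interior-point ℚ.+ mesh 1 (suc n) ℚ.≤ upper-end d n
    interior-point+mesh≤upper-end = begin
      interior-point ℚ.+ mesh 1 (suc n)    ≡⟨ mesh-+ (suc n) (1 ℕ.+ b ℕ.* c) 1 ⟨
      mesh (1 ℕ.+ b ℕ.* c ℕ.+ 1) (suc n)   ≤⟨ mesh-mono-≤ (suc n) 2+bc≤b[1+c] ⟩
      mesh (b ℕ.* suc c) (suc n)           ≡⟨ mesh-refine n (suc c) ⟨
      upper-end d n                        ∎
      where
      open ℚ.≤-Reasoning
      2+bc≤b[1+c] : 1 ℕ.+ b ℕ.* c ℕ.+ 1 ℕ.≤ b ℕ.* suc c
      2+bc≤b[1+c] = ℕ.≤-trans (ℕ.≤-reflexive (ℕ.+-comm (1 ℕ.+ b ℕ.* c) 1))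
        (ℕ.≤-trans (ℕ.+-monoˡ-≤ (b ℕ.* c) 2≤b) (ℕ.≤-reflexive (sym (ℕ.*-suc b c))))

    interior-point≤upper-end : interior-point ℚ.≤ upper-end d n
    interior-point≤upper-end = ℚ.≤-trans
      (ℚ.≤-trans (mesh-mono-≤ (suc n) (ℕ.m≤m+n _ 1)) (ℚ.≤-reflexive (mesh-+ (suc n) (1 ℕ.+ b ℕ.* c) 1)))
      interior-point+mesh≤upper-end

    near⇒inCell : ∀ x → Near (mesh 1 (suc n)) (fromℚ interior-point) x → InCell x n c
    near⇒inCell x (point< , <point)
      with <⊕-elim (fromℚ interior-point) x point< | <⊕-elim x (fromℚ interior-point) <point
    ... | q , r , q∉ , r∈x , q<r+δ | q′ , r′ , q′∉x , (_ , refl , r′<point) , q′<r′+δ =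
      below-≤ x lower≤r r∈x , λ upper∈x → q′∉x (down x q′<upper upper∈x)
      where
      δ = mesh 1 (suc n)
      lower≤r : lower-end d n ℚ.≤ r
      lower≤r = ℚ.<⇒≤ (+-cancelʳ-< δ (begin-strict
        lower-end d n ℚ.+ δ            ≡⟨ ℚ.+-comm _ δ ⟩
        δ ℚ.+ lower-end d n            ≡⟨ cong (δ ℚ.+_) (mesh-refine n c) ⟩
        δ ℚ.+ mesh (b ℕ.* c) (suc n)   ≡⟨ mesh-+ (suc n) 1 (b ℕ.* c) ⟨
        interior-point                 ≤⟨ ∉fromℚ⇒≤ q∉ ⟩
        q                              <⟨ q<r+δ ⟩
        r ℚ.+ δ                        ∎))
        where open ℚ.≤-Reasoning
      q′<upper : q′ ℚ.< upper-end d n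
      q′<upper = ℚ.<-trans q′<r′+δ (ℚ.<-≤-trans (ℚ.+-monoˡ-< δ r′<point) interior-point+mesh≤upper-end)

    -- Cells are nested, so `x` and the interior point share a cell of level `m`, whose length is
    -- below `ε`.
    inCell⇒near : ∀ {ε m} x (e : Digits b) → ℚ.↧ₙ ε ℕ.≤ m → 0ℚ ℚ.< ε → m ℕ.≤ n → Agree m e d →
                  InCell x m (numerator e m) → Near ε x (fromℚ interior-point)
    inCell⇒near {ε} {m} x e N≤m 0<ε m≤n e≡d (lower∈x , upper∉x) =
      <⊕-intro x (fromℚ interior-point) upper∉x (_ , refl , lower<point) upper<lower+ε ,
      <⊕-intro (fromℚ interior-point) x (∉fromℚ ℚ.≤-refl) lower∈x
        (ℚ.≤-<-trans point≤upper upper<lower+ε)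
      where
      eq : numerator e m ≡ numerator d m
      eq = numerator-cong m e≡d
      lower<point : lower-end e m ℚ.< interior-point
      lower<point = ℚ.≤-<-trans (ℚ.≤-trans (ℚ.≤-reflexive (cong (λ c → mesh c m) eq))
        (lower-end-mono d (ℕ.≤⇒≤′ m≤n))) lower-end<interior-point
      point≤upper : interior-point ℚ.≤ upper-end e m
      point≤upper = ℚ.≤-trans interior-point≤upper-end (ℚ.≤-trans (upper-end-anti d (ℕ.≤⇒≤′ m≤n))
        (ℚ.≤-reflexive (cong (λ c → mesh (suc c) m) (sym eq))))
      upper<lower+ε : upper-end e m ℚ.< lower-end e m ℚ.+ ε
      upper<lower+ε = ℚ.≤-<-trans (ℚ.≤-reflexive (upper-end≡ e m))
        (ℚ.+-monoʳ-< (lower-end e m) (mesh-small m N≤m 0<ε))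

    interior-point∈⟨0,1] : ⟨0,1]
    interior-point∈⟨0,1] = record
      { value    = fromℚ interior-point
      ; positive = 0ℚ , ∉fromℚ ℚ.≤-refl , _ , refl , 0<point
      ; ≤one     = λ { (_ , refl , q<point) → _ , refl , ℚ.<-≤-trans q<point point≤1 }
      }
      where
      0<point : 0ℚ ℚ.< interior-point
      0<point = ℚ.≤-<-trans (ℚ.≤-trans (ℚ.≤-reflexive (sym (mesh-0 0)))
        (lower-end-mono d (ℕ.≤⇒≤′ (ℕ.z≤n {n})))) lower-end<interior-point
      point≤1 : interior-point ℚ.≤ 1ℚ
      point≤1 = ℚ.≤-trans interior-point≤upper-end
        (ℚ.≤-trans (upper-end-anti d (ℕ.≤⇒≤′ (ℕ.z≤n {n}))) (ℚ.≤-reflexive (mesh≡/ 1 0)))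

    -- A cylinder contains a ball: the ball lies in one cell of level `n`, and that cell determines
    -- the first `n` digits.
    near⇒agree : ∀ x {d′} → Near (mesh 1 (suc n)) (fromℚ interior-point) x →
                 IsDigitSequence x d′ → Agree n d d′
    near⇒agree x {d′} near isDigits = numerator-injective n
      (inCell-unique x n (near⇒inCell x near) (digits⇒cells d′ x isDigits n))

  -- Suppose the closure contains a ball. Extend a prefix of the centre's digits to a pair of
  -- cylinders on which `P` fails. Their interior points form a point of the ball, and a smaller
  -- ball around it stays in the cylinders, so it misses the set.
  avoidable⇒nowhereDense : ExcludedMiddle 0ℓ → ∀ P → Avoidable P → NowhereDense (Realised P)
  avoidable⇒nowhereDense em P avoid (x , y) (ε , 0<ε , ball⊆closure) =
    miss (digits-exist em x) (digits-exist em y)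
    where
    -- At this depth cells are shorter than `ε`, so extending the prefix does not leave the ball.
    m = ℚ.↧ₙ ε

    ball-misses : ∀ d′ e′ n → (∀ {d″ e″} → Agree n d′ d″ → Agree n e′ e″ → ¬ P d″ e″) → ∀ q →
                  q ∈ Ball (interior-point∈⟨0,1] d′ n , interior-point∈⟨0,1] e′ n) (mesh 1 (suc n)) →
                  q ∉ Realised P
    ball-misses d′ e′ n ¬P (x″ , y″) (near-x , near-y) (_ , _ , d″-digits , e″-digits , p) =
      ¬P (near⇒agree d′ n (value x″) near-x d″-digits) (near⇒agree e′ n (value y″) near-y e″-digits) p

    extension-misses : ∀ {d e} → IsDigitSequence (value x) d → IsDigitSequence (value y) e →
                       ¬ AvoidingExtension P d e m
    extension-misses {d} {e} d-digits e-digits (d′ , e′ , n , m≤n , d≡d′ , e≡e′ , ¬P) =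
      ball-misses d′ e′ n ¬P (proj₁ hit) (proj₁ (proj₂ hit)) (proj₂ (proj₂ hit))
      where
      hit = ball⊆closure {interior-point∈⟨0,1] d′ n , interior-point∈⟨0,1] e′ n}
        ( inCell⇒near d′ n (value x) d ℕ.≤-refl 0<ε m≤n d≡d′ (digits⇒cells d (value x) d-digits m)
        , inCell⇒near e′ n (value y) e ℕ.≤-refl 0<ε m≤n e≡e′ (digits⇒cells e (value y) e-digits m) )
        (mesh 1 (suc n))
        (ℚ.≤-<-trans (ℚ.≤-reflexive (sym (mesh-0 (suc n)))) (mesh-mono-< (suc n) (ℕ.n<1+n 0)))

    miss : ∃ (IsDigitSequence (value x)) → ¬ ∃ (IsDigitSequence (value y))
    miss (d , d-digits) (e , e-digits) = extension-misses d-digits e-digits (avoid d e m)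

  -- Growth of the longest common substring

  avoid-long : ∀ K → Avoidable (LongAtPowers K)
  avoid-long K d e m =
    -- The fixed prefix covers the first `b ^ t` digits, which determine the longest common
    -- substring there.
    splice m d 0ᵈ , splice m e 1ᵈ , m ℕ.+ b ℕ.^ t , ℕ.m≤m+n m _ ,
    agree-splice m d 0ᵈ , agree-splice m e 1ᵈ ,
    λ d≡ e≡ long → ℕ.<⇒≱ (ℕ.m≤n+m (suc (K ℕ.* m)) K) (ℕ.≤-trans (long t (ℕ.m≤m+n K _))
      (ℕ.*-monoʳ-≤ K (disagreeing-tails 0≢1 (ℕ.m≤n+m (b ℕ.^ t) m) d≡ e≡)))
    where
    -- At least `K`, and larger than `K * m`, which would bound `t` if the property held.
    t = K ℕ.+ suc (K ℕ.* m)
    0<b : 0 ℕ.< b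
    0<b = ℕ.<-trans (ℕ.n<1+n 0) 2≤b
    0ᵈ 1ᵈ : Fin b
    0ᵈ = fromℕ< 0<b
    1ᵈ = fromℕ< 2≤b
    0≢1 : 0ᵈ ≢ 1ᵈ
    0≢1 eq = contradiction (trans (sym (toℕ-fromℕ< 0<b)) (trans (cong toℕ eq) (toℕ-fromℕ< 2≤b))) λ ()

  -- With `t = 2s` and `s = 2K + m`, the power is at least `(s + 1)²`, while `K t + m` is at most
  -- `s² + s`.
  b^t-dominates : ∀ K m → ∃ λ t → K ℕ.≤ t × K ℕ.* t ℕ.+ m ℕ.< b ℕ.^ t
  b^t-dominates K m = s ℕ.+ s , ℕ.≤-trans K≤s (ℕ.m≤m+n s s) , (begin-strict
    K ℕ.* (s ℕ.+ s) ℕ.+ m          ≡⟨ cong (ℕ._+ m) (trans (ℕ.*-distribˡ-+ K s s) (sym (ℕ.*-distribʳ-+ s K K))) ⟩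
    (K ℕ.+ K) ℕ.* s ℕ.+ m          ≤⟨ ℕ.+-mono-≤ (ℕ.*-monoˡ-≤ s (ℕ.m≤m+n (K ℕ.+ K) m)) (ℕ.m≤n+m m (K ℕ.+ K)) ⟩
    s ℕ.* s ℕ.+ s                  ≡⟨ ℕ.+-comm (s ℕ.* s) s ⟩
    s ℕ.+ s ℕ.* s                  ≡⟨ ℕ.*-suc s s ⟨
    s ℕ.* suc s                    <⟨ ℕ.m<n+m _ (ℕ.s≤s ℕ.z≤n) ⟩
    suc s ℕ.* suc s                ≤⟨ ℕ.*-mono-≤ (n<b^n s) (n<b^n s) ⟩
    b ℕ.^ s ℕ.* b ℕ.^ s            ≡⟨ ℕ.^-distribˡ-+-* b s s ⟨
    b ℕ.^ (s ℕ.+ s)                ∎)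
    where
    open ℕ.≤-Reasoning
    s = K ℕ.+ K ℕ.+ m
    K≤s : K ℕ.≤ s
    K≤s = ℕ.≤-trans (ℕ.m≤m+n K K) (ℕ.m≤m+n (K ℕ.+ K) m)

  -- The common tail of 0s has length `b ^ t - m` within the first `b ^ t` digits, and this exceeds
  -- `K t` for a suitable `t`.
  avoid-short : ∀ K → Avoidable (ShortAtPowers K)
  avoid-short K d e m with b^t-dominates K m
  ... | t , K≤t , Kt+m<b^t =
    splice m d 0ᵈ , splice m e 0ᵈ , m ℕ.+ b ℕ.^ t , ℕ.m≤m+n m _ ,
    agree-splice m d 0ᵈ , agree-splice m e 0ᵈ ,
    λ d≡ e≡ short → ℕ.<⇒≱ (ℕ.m+n≤o⇒m≤o∸n (suc (K ℕ.* t)) Kt+m<b^t)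
      (ℕ.≤-trans (agreeing-tails (ℕ.≤-trans (ℕ.m≤n+m m (K ℕ.* t)) (ℕ.<⇒≤ Kt+m<b^t))
                                 (ℕ.m≤n+m (b ℕ.^ t) m) d≡ e≡)
                 (short t K≤t))
    where
    0ᵈ : Fin b
    0ᵈ = fromℕ< (ℕ.<-trans (ℕ.n<1+n 0) 2≤b)

  -- Logarithms and ratios at powers of the base

  log-< : ∀ {n} t {q} → n ℕ.≤ b ℕ.^ t → q ∈ below (log b n) → q ℚ.< + t ℚ./ 1
  log-< {n} t n≤b^t (_ , (m , k , refl , b^m≤n^k) , q<m/k) = ℚ.<-≤-trans q<m/k
    (/-mono-≤ m t (suc k) 1 (ℕ.≤-trans (ℕ.≤-reflexive (ℕ.*-identityʳ m)) m≤tk))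
    where
    m≤tk : m ℕ.≤ t ℕ.* suc k
    m≤tk = ℕ.≮⇒≥ λ tk<m → ℕ.<⇒≱ (ℕ.^-monoʳ-< b 2≤b tk<m)
      (ℕ.≤-trans b^m≤n^k (ℕ.≤-trans (ℕ.^-monoˡ-≤ (suc k) n≤b^t) (ℕ.≤-reflexive (ℕ.^-*-assoc b t (suc k)))))

  -- The fraction `t / 1` is itself admissible in the supremum. With `log-<` this identifies
  -- `log b (b ^ t)` as `t`.
  log-≥ : ∀ t {q} → q ∉ below (log b (b ℕ.^ t)) → + t ℚ./ 1 ℚ.≤ q
  log-≥ t q∉log = ℚ.≮⇒≥ λ q<t → q∉log (_ , (t , 0 , refl , ℕ.≤-reflexive (sym (ℕ.*-identityʳ _))) , q<t)

  module _ {d e : Digits b} where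

    private
      s : ℕ → ℕ
      s = longestCommon d e

    -- Here `c` exceeds 1 over the denominator of `q`, and `r` is at least `t`; the bound on `c r`
    -- then gives the claim after clearing denominators.
    ratio-lower : ∀ t {q} → 0ℚ ℚ.< q → q ∈ below (ratio d e (b ℕ.^ t)) → t ℕ.≤ ℚ.↧ₙ q ℕ.* s (b ℕ.^ t)
    ratio-lower t {q} 0<q (c , (r , 0<r , r∉log , cr≤s) , q<c) = begin
      t                                  ≡⟨ trans (ℕ.*-identityʳ _) (ℕ.*-identityˡ t) ⟨
      1 ℕ.* t ℕ.* 1                      ≤⟨ /-cancel-≤ (1 ℕ.* t) (s (b ℕ.^ t)) (ℚ.↧ₙ q ℕ.* 1) 1
                                            {{ℕ.m*n≢0 (ℚ.↧ₙ q) 1}} t/D≤s ⟩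
      s (b ℕ.^ t) ℕ.* (ℚ.↧ₙ q ℕ.* 1)     ≡⟨ cong (s (b ℕ.^ t) ℕ.*_) (ℕ.*-identityʳ _) ⟩
      s (b ℕ.^ t) ℕ.* ℚ.↧ₙ q             ≡⟨ ℕ.*-comm (s (b ℕ.^ t)) _ ⟩
      ℚ.↧ₙ q ℕ.* s (b ℕ.^ t)             ∎
      where
      open ℕ.≤-Reasoning
      t/D≤s : ℚ._/_ (+ (1 ℕ.* t)) (ℚ.↧ₙ q ℕ.* 1) {{ℕ.m*n≢0 (ℚ.↧ₙ q) 1}} ℚ.≤ + s (b ℕ.^ t) ℚ./ 1
      t/D≤s =
        ℚ.≤-trans (ℚ.≤-reflexive (sym (/-homo-* 1 t (ℚ.↧ₙ q) 1))) (
        ℚ.≤-trans (ℚ.*-monoˡ-≤-nonNeg (+ 1 ℚ./ ℚ.↧ₙ q)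
                    {{ℚ.nonNegative (/-mono-≤ 0 1 1 (ℚ.↧ₙ q) ℕ.z≤n)}} (log-≥ t r∉log)) (
        ℚ.≤-trans (ℚ.*-monoʳ-≤-nonNeg r {{ℚ.nonNegative (ℚ.<⇒≤ 0<r)}}
                    (ℚ.≤-trans (1/↧≤ 0<q) (ℚ.<⇒≤ q<c))) cr≤s))

    -- Otherwise the natural number `c`, chosen above `q`, would put `q` below the ratio, with
    -- `r = t`.
    ratio-upper : ∀ t {q} → 1 ℕ.≤ t → q ∉ below (ratio d e (b ℕ.^ t)) →
                  s (b ℕ.^ t) ℕ.≤ suc ℤ.∣ ℚ.↥ q ∣ ℕ.* t
    ratio-upper t {q} 1≤t q∉ratio = ℕ.≮⇒≥ λ ct<s → q∉ratio
      ( + c ℚ./ 1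
      , ( + t ℚ./ 1 , /-mono-< 0 t 1 1 (ℕ.≤-trans 1≤t (ℕ.≤-reflexive (sym (ℕ.*-identityʳ t))))
        , (λ t∈log → ℚ.<-irrefl refl (log-< t ℕ.≤-refl t∈log))
        , ℚ.≤-trans (ℚ.≤-reflexive (/-homo-* c t 1 1))
            (/-mono-≤ (c ℕ.* t) (s (b ℕ.^ t)) 1 1 (ℕ.*-monoˡ-≤ 1 (ℕ.<⇒≤ ct<s))))
      , ℚ.≤-<-trans (≤∣↥∣ q) (/-mono-< ℤ.∣ ℚ.↥ q ∣ c 1 1 (ℕ.*-monoˡ-< 1 (ℕ.n<1+n ℤ.∣ ℚ.↥ q ∣))))
      where c = suc ℤ.∣ ℚ.↥ q ∣

    ratio-nonNegative : ∀ n {q} → q ℚ.< 0ℚ → q ∈ below (ratio d e n)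
    ratio-nonNegative n q<0 = 0ℚ ,
      -- A positive bound for the logarithm at every `n`, including the degenerate terms 0 and 1.
      ( + suc n ℚ./ 1 , /-mono-< 0 (suc n) 1 1 (ℕ.s≤s ℕ.z≤n)
      , (λ ∈log → ℚ.<-irrefl refl (log-< (suc n) (ℕ.≤-trans (ℕ.n≤1+n n) (ℕ.<⇒≤ (n<b^n (suc n)))) ∈log))
      , ℚ.≤-trans (ℚ.≤-reflexive (ℚ.*-zeroˡ (+ suc n ℚ./ 1))) (/-mono-≤ 0 (s n) 1 1 ℕ.z≤n)) , q<0

    eventually-above⇒long : ∀ N {q} → 0ℚ ℚ.< q → (∀ n → N ℕ.≤ n → q ∈ below (ratio d e n)) →
                            ∃ λ K → LongAtPowers K d e
    -- The first summand supplies the factor; the second forces `b ^ t` past `N`.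
    eventually-above⇒long N {q} 0<q above = ℚ.↧ₙ q ℕ.+ N , λ t K≤t → ℕ.≤-trans
      (ratio-lower t 0<q (above (b ℕ.^ t) (ℕ.<⇒≤ (ℕ.≤-<-trans (ℕ.≤-trans (ℕ.m≤n+m N _) K≤t) (n<b^n t)))))
      (ℕ.*-monoˡ-≤ (s (b ℕ.^ t)) (ℕ.m≤m+n (ℚ.↧ₙ q) N))

    eventually-below⇒short : ∀ N {q} → (∀ n → N ℕ.≤ n → q ∉ below (ratio d e n)) →
                             ∃ λ K → ShortAtPowers K d e
    -- The successor also guarantees that `t` is positive, as `ratio-upper` requires.
    eventually-below⇒short N {q} notAbove = suc ℤ.∣ ℚ.↥ q ∣ ℕ.+ N , λ t K≤t → ℕ.≤-trans
      (ratio-upper t (ℕ.≤-trans (ℕ.s≤s ℕ.z≤n) K≤t)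
        (notAbove (b ℕ.^ t) (ℕ.<⇒≤ (ℕ.≤-<-trans (ℕ.≤-trans (ℕ.m≤n+m N _) K≤t) (n<b^n t)))))
      (ℕ.*-monoˡ-≤ t (ℕ.m≤m+n (suc ℤ.∣ ℚ.↥ q ∣) N))

    converges⇒long : ∀ α → 0# < α → Converges (ratio d e) α → ∃ λ K → LongAtPowers K d e
    converges⇒long α (q , q∉0 , q∈α) conv =
      let
        -- The rational `q` may be 0, so `q₁` is taken strictly positive; the gap up to `q₂` is the
        -- tolerance that keeps the ratios above `q₁`.
        q₁ , q<q₁ , q₁∈α = open′ α q∈α
        q₂ , q₁<q₂ , q₂∈α = open′ α q₁∈α
        N , near = conv (q₂ ℚ.- q₁) (x<y⇒0<y-x q₁<q₂)
      in eventually-above⇒long N (ℚ.≤-<-trans (∉fromℚ⇒≤ q∉0) q<q₁) λ n N≤n →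
        let u , r , u∉α , r∈ratio , u<r+ε = <⊕-elim α (ratio d e n) (proj₂ (near n N≤n))
        in down (ratio d e n)
             (+-cancelʳ-< (q₂ ℚ.- q₁) (ℚ.≤-<-trans (ℚ.≤-reflexive (x+[y-x]≡y q₁ q₂))
               (ℚ.<-trans (∈∉⇒< α q₂∈α u∉α) u<r+ε)))
             r∈ratio

    module _ (em : ExcludedMiddle 0ℓ) where

      -- The ratios are nonnegative, so a nonzero lower limit has some `q ≥ 0` below it, and then a
      -- positive rational lies below a whole tail.
      liminf≄0⇒long : ¬ liminf (ratio d e) ≃ 0# → ∃ λ K → LongAtPowers K d e
      liminf≄0⇒long liminf≄0 = case em {∃ λ q → 0ℚ ℚ.≤ q × q ∈ below (liminf (ratio d e))} of λ where
        (no none) → contradiction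
          ( (λ {q} q∈liminf → 0ℚ , refl , ℚ.≰⇒> λ 0≤q → none (q , 0≤q , q∈liminf))
          , λ { (_ , refl , q<0) → let
                  r  , q<r  , r<0  = ℚ.<-dense q<0
                  r′ , r<r′ , r′<0 = ℚ.<-dense r<0
                in r , (0 , r′ , (λ n → ratio-nonNegative n r′<0) , r<r′) , q<r } )
          liminf≄0
        (yes (q , 0≤q , r , (N , r′ , above , r<r′) , q<r)) →
          eventually-above⇒long N (ℚ.≤-<-trans 0≤q (ℚ.<-trans q<r r<r′))
            λ n N≤n → subst (λ n → r′ ∈ below (ratio d e n)) (ℕ.m+[n∸m]≡n N≤n) (above (n ℕ.∸ N))

      -- If no tail had a rational upper bound, every rational would lie below the supremum of every
      -- tail.
      limsup≄∞⇒short : ¬ limsup (ratio d e) ≃ ∞ → ∃ λ K → ShortAtPowers K d e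
      limsup≄∞⇒short limsup≄∞ = decide em
        where
        BoundedTail : Set
        BoundedTail = ∃ λ q → ∃ λ N → ∀ n → q ∉ below (ratio d e (N ℕ.+ n))

        q<q+1 : ∀ q → q ℚ.< q ℚ.+ 1ℚ
        q<q+1 q = ℚ.≤-<-trans (ℚ.≤-reflexive (sym (ℚ.+-identityʳ q))) (ℚ.+-monoʳ-< q (/-mono-< 0 1 1 1 ℕ.≤-refl))

        -- Each of the two suprema behind `limsup` asks for a strictly larger rational, so two units
        -- of slack are spent.
        often : ¬ BoundedTail → ∀ q N → q ℚ.+ 1ℚ ∈ below (sup λ n → ratio d e (N ℕ.+ n))
        often unbounded q N = case em {∃ λ n → q ℚ.+ 1ℚ ℚ.+ 1ℚ ∈ below (ratio d e (N ℕ.+ n))} of λ where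
          (yes (n , q+2∈)) → q ℚ.+ 1ℚ ℚ.+ 1ℚ , (n , q+2∈) , q<q+1 (q ℚ.+ 1ℚ)
          (no never) → contradiction (q ℚ.+ 1ℚ ℚ.+ 1ℚ , N , λ n q+2∈ → never (n , q+2∈)) unbounded

        decide : Dec BoundedTail → ∃ λ K → ShortAtPowers K d e
        decide (yes (q , N , notAbove)) = eventually-below⇒short N
          λ n N≤n → subst (λ n → q ∉ below (ratio d e n)) (ℕ.m+[n∸m]≡n N≤n) (notAbove (n ℕ.∸ N))
        decide (no unbounded) = contradiction
          ( (λ {q} _ → q ℚ.+ 1ℚ , _ , q<q+1 q)
          , λ {q} _ → q ℚ.+ 1ℚ , often unbounded q , q<q+1 q)
          limsup≄∞

-- Covers by nowhere dense sets

nowhereDense-⊆ : ∀ {A B : Pred Square 0ℓ} → A ⊆ B → NowhereDense B → NowhereDense A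
nowhereDense-⊆ A⊆B B-nowhere p (ε , 0<ε , ball⊆) = B-nowhere p
  (ε , 0<ε , λ {q} q∈ball δ 0<δ →
    let r , r∈ball , r∈A = ball⊆ {q} q∈ball δ 0<δ in r , r∈ball , A⊆B {r} r∈A)

-- First category is defined by an equality with a union, so each covering set is cut down to its
-- intersection with `A`.
firstCategory-⊆⋃ : ∀ {A : Pred Square 0ℓ} (B : ℕ → Pred Square 0ℓ) → (∀ n → NowhereDense (B n)) →
                   (∀ {p} → p ∈ A → ∃ λ n → p ∈ B n) → FirstCategory A
firstCategory-⊆⋃ {A} B B-nowhere A⊆⋃B =
  (λ n p → p ∈ A × p ∈ B n) ,
  (λ n → nowhereDense-⊆ {B = B n} proj₂ (B-nowhere n)) ,
  (λ {p} p∈A → let n , p∈Bₙ = A⊆⋃B {p} p∈A in n , p∈A , p∈Bₙ) ,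
  (λ { (_ , p∈A , _) → p∈A })

theorem1p2 : ExcludedMiddle (lsuc 0ℓ) →
    ∀ (b : ℕ) → 2 ℕ.≤ b →
    (∀ (α : ℝ̄) → 0# < α → α < ∞ → FirstCategory (S b α)) × Residual (S⟨0,∞⟩ b)
theorem1p2 em₁ b 2≤b =
  (λ α 0<α _ → firstCategory-⊆⋃ B B-nowhereDense λ { (d , e , x-digits , y-digits , conv) →
     let K , long = converges⇒long 2≤b α 0<α conv in K , d , e , x-digits , y-digits , inj₁ long }) ,
  firstCategory-⊆⋃ B B-nowhereDense λ { {x , y} → outside x y (digits-exist 2≤b em x) (digits-exist 2≤b em y) }
  where
  em : ExcludedMiddle 0ℓ
  em = map′ lower lift em₁

  -- One countable family covers both `S b α` for every positive `α` and the complement of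
  -- `S⟨0,∞⟩ b`.
  B : ℕ → Pred Square 0ℓ
  B K = Realised {b} λ d e → LongAtPowers K d e ⊎ ShortAtPowers K d e

  B-nowhereDense : ∀ K → NowhereDense (B K)
  B-nowhereDense K = avoidable⇒nowhereDense 2≤b em _ (avoidable-⊎ (avoid-long 2≤b K) (avoid-short 2≤b K))

  outside : ∀ x y → ∃ (IsDigitSequence {b} (value x)) → ∃ (IsDigitSequence {b} (value y)) →
            (x , y) ∉ S⟨0,∞⟩ b → ∃ λ K → (x , y) ∈ B K
  outside x y (d , x-digits) (e , y-digits) ∉S = case em {liminf (ratio d e) ≃ 0#} of λ where
    (no  liminf≄0) → let K , long = liminf≄0⇒long 2≤b em liminf≄0 in
      K , d , e , x-digits , y-digits , inj₁ long
    (yes liminf≃0) → let K , short = limsup≄∞⇒short 2≤b em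
                           (λ limsup≃∞ → ∉S (d , e , x-digits , y-digits , liminf≃0 , limsup≃∞)) in
      K , d , e , x-digits , y-digits , inj₂ short
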